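{- Consistency in $\mathcal{SSCC}$ is undecidable, even if the numerical constraints occurring in the TBox contain no transitive roles and no constants other than $0$ or $1$.
   Context: QFBAPA constraints: set constraints $s\subseteq t$, $s=t$ over set terms built from set variables, $\emptyset$, $\mathcal{U}$ using $\cap,\cup,{}^c$; numerical constraints $\ell=\ell'$, $\ell<\ell'$, $n\mathrel{\mathsf{div}}\ell$ over PA expressions $n_0+n_1|s_1|+\dots+n_k|s_k|$ ($n_i\in\mathbb{N}$). $\mathcal{ALCSCC}$ concepts are concept names $A$, $\neg C$, $C\sqcap D$ and $\mathsf{succ}(\mathfrak{con})$ with $\mathfrak{con}$ a set or numerical constraint whose set variables are role names and concepts. Interpretations must be finitely branching (each $d$ has finitely many role successors $\mathsf{ars}^\mathcal{I}(d)=\bigcup_r r^\mathcal{I}(d)$); $d\in\mathsf{succ}(\mathfrak{con})^\mathcal{I}$ iff $\mathfrak{con}$ holds under $\mathcal{U}\mapsto\mathsf{ars}^\mathcal{I}(d)$, $r\mapsto r^\mathcal{I}(d)$, $C\mapsto C^\mathcal{I}\cap\mathsf{ars}^\mathcal{I}(d)$. $\mathcal{SSCC}$ extends $\mathcal{ALCSCC}$ with transitivity axioms $\mathsf{trans}(r)$ in the TBox (a finite set of CIs $C\sqsubseteq D$ and transitivity axioms), requiring $r^\mathcal{I}$ to be transitive in models; a role name is transitive if it occurs in such an axiom. A TBox is consistent if it has a finitely branching model. "No constants other than 0 or 1" means all natural-number constants and coefficients in numerical constraints are $0$ or $1$. -}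

module Defs where

open import Data.Nat using (ℕ; zero; suc; _+_; _*_; _≡ᵇ_; _<ᵇ_; _≤ᵇ_)
open import Data.Nat.Divisibility using (_∣?_)
open import Data.Bool using (Bool; true; false; _∧_; _∨_; not; if_then_else_)
open import Data.List using (List; []; _∷_)
open import Data.Bool.ListAction using (any)
open import Data.Product using (_×_; _,_; ∃)
open import Data.List.Membership.Propositional using (_∈_)
open import Data.List.Relation.Unary.Unique.Propositional using (Unique)
open import Relation.Binary.PropositionalEquality using (_≡_)
open import Relation.Nullary.Decidable using (isYes)

mutual
  data Concept : Set where
    atom : ℕ → Concept
    neg  : Concept → Concept
    and  : Concept → Concept → Concept
    succ : Constraint → Concept

  -- QFBAPA set terms whose set variables are role names and concepts
  data SetTerm : Set where
    role    : ℕ → SetTerm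
    concept : Concept → SetTerm
    empty   : SetTerm
    univ    : SetTerm
    inter   : SetTerm → SetTerm → SetTerm
    union   : SetTerm → SetTerm → SetTerm
    compl   : SetTerm → SetTerm

  -- PA expression  n₀ + n₁|s₁| + … + nₖ|sₖ|
  data PAExpr : Set where
    pa : ℕ → List (ℕ × SetTerm) → PAExpr

  data Constraint : Set where
    subset : SetTerm → SetTerm → Constraint
    seteq  : SetTerm → SetTerm → Constraint
    numeq  : PAExpr → PAExpr → Constraint
    numlt  : PAExpr → PAExpr → Constraint
    ndiv   : ℕ → PAExpr → Constraint

data Axiom : Set where
  ci    : Concept → Concept → Axiom
  trans : ℕ → Axiom

TBox : Set
TBox = List Axiom

-- Semantics.  An interpretation has a non-empty domain, Boolean-valued
-- extensions of concept and role names, and is finitely branching: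
-- ars d is a duplicate-free finite list that is exactly the set of all
-- role successors of d.

record Interp : Set₁ where
  field
    Δ      : Set
    elem   : Δ
    conc   : ℕ → Δ → Bool
    rol    : ℕ → Δ → Δ → Bool
    ars    : Δ → List Δ
    ars-unique   : ∀ d → Unique (ars d)
    ars-complete : ∀ r d e → rol r d e ≡ true → e ∈ ars d
    ars-sound    : ∀ d e → e ∈ ars d → ∃ λ r → rol r d e ≡ true

module Sem (I : Interp) where
  open Interp I

  mutual
    ⟦_⟧c : Concept → Δ → Bool
    ⟦ atom A ⟧c x = conc A x
    ⟦ neg C ⟧c x = not (⟦ C ⟧c x)
    ⟦ and C D ⟧c x = ⟦ C ⟧c x ∧ ⟦ D ⟧c x
    ⟦ succ k ⟧c x = ⟦ k ⟧k x

    -- membership of a successor e of d in the value of a set term,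
    -- under 𝒰 ↦ ars(d), r ↦ r^I(d), C ↦ C^I ∩ ars(d)
    -- (only ever evaluated on e ∈ ars d)
    ⟦_⟧s : SetTerm → Δ → Δ → Bool
    ⟦ role r ⟧s d e = rol r d e
    ⟦ concept C ⟧s d e = ⟦ C ⟧c e
    ⟦ empty ⟧s d e = false
    ⟦ univ ⟧s d e = true
    ⟦ inter s t ⟧s d e = ⟦ s ⟧s d e ∧ ⟦ t ⟧s d e
    ⟦ union s t ⟧s d e = ⟦ s ⟧s d e ∨ ⟦ t ⟧s d e
    ⟦ compl s ⟧s d e = not (⟦ s ⟧s d e)

    -- number of elements of the list satisfying s (cardinality, as ars d is duplicate-free)
    count : SetTerm → Δ → List Δ → ℕ
    count s d [] = 0
    count s d (e ∷ es) = (if ⟦ s ⟧s d e then 1 else 0) + count s d es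

    incl : SetTerm → SetTerm → Δ → List Δ → Bool
    incl s t d [] = true
    incl s t d (e ∷ es) = (not (⟦ s ⟧s d e) ∨ ⟦ t ⟧s d e) ∧ incl s t d es

    sumTerms : List (ℕ × SetTerm) → Δ → ℕ
    sumTerms [] d = 0
    sumTerms ((n , s) ∷ ts) d = n * count s d (ars d) + sumTerms ts d

    ⟦_⟧e : PAExpr → Δ → ℕ
    ⟦ pa n₀ ts ⟧e d = n₀ + sumTerms ts d

    ⟦_⟧k : Constraint → Δ → Bool
    ⟦ subset s t ⟧k d = incl s t d (ars d)
    ⟦ seteq s t ⟧k d = incl s t d (ars d) ∧ incl t s d (ars d)
    ⟦ numeq l l' ⟧k d = ⟦ l ⟧e d ≡ᵇ ⟦ l' ⟧e d
    ⟦ numlt l l' ⟧k d = ⟦ l ⟧e d <ᵇ ⟦ l' ⟧e d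
    ⟦ ndiv n l ⟧k d = isYes (n ∣? ⟦ l ⟧e d)

  Transitive : ℕ → Set
  Transitive r = ∀ x y z → rol r x y ≡ true → rol r y z ≡ true → rol r x z ≡ true

  Satisfies : Axiom → Set
  Satisfies (ci C D) = ∀ x → ⟦ C ⟧c x ≡ true → ⟦ D ⟧c x ≡ true
  Satisfies (trans r) = Transitive r

  IsModel : TBox → Set
  IsModel T = ∀ ax → ax ∈ T → Satisfies ax

Consistent : TBox → Set₁
Consistent T = ∃ λ (I : Interp) → Sem.IsModel I T

transRoles : TBox → List ℕ
transRoles [] = []
transRoles (ci _ _ ∷ T) = transRoles T
transRoles (trans r ∷ T) = r ∷ transRoles T

module Restr (tr : List ℕ) where
  isTrans : ℕ → Bool
  isTrans r = any (r ≡ᵇ_) tr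

  is01 : ℕ → Bool
  is01 n = n ≤ᵇ 1

  mutual
    okC : Concept → Bool
    okC (atom _) = true
    okC (neg C) = okC C
    okC (and C D) = okC C ∧ okC D
    okC (succ k) = okK k

    okS : SetTerm → Bool
    okS (role _) = true
    okS (concept C) = okC C
    okS empty = true
    okS univ = true
    okS (inter s t) = okS s ∧ okS t
    okS (union s t) = okS s ∧ okS t
    okS (compl s) = okS s

    -- no transitive role occurs as a set variable of the set term
    -- (roles inside nested concepts belong to other constraints)
    noTr : SetTerm → Bool
    noTr (role r) = not (isTrans r)
    noTr (concept _) = true
    noTr empty = true
    noTr univ = true
    noTr (inter s t) = noTr s ∧ noTr t
    noTr (union s t) = noTr s ∧ noTr t
    noTr (compl s) = noTr s

    okTerms : List (ℕ × SetTerm) → Bool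
    okTerms [] = true
    okTerms ((n , s) ∷ ts) = is01 n ∧ noTr s ∧ okS s ∧ okTerms ts

    okE : PAExpr → Bool
    okE (pa n₀ ts) = is01 n₀ ∧ okTerms ts

    okK : Constraint → Bool
    okK (subset s t) = okS s ∧ okS t
    okK (seteq s t) = okS s ∧ okS t
    okK (numeq l l') = okE l ∧ okE l'
    okK (numlt l l') = okE l ∧ okE l'
    okK (ndiv n l) = is01 n ∧ okE l

  okAx : Axiom → Bool
  okAx (ci C D) = okC C ∧ okC D
  okAx (trans _) = true

  okT : TBox → Bool
  okT [] = true
  okT (ax ∷ T) = okAx ax ∧ okT T

Restricted : TBox → Bool
Restricted T = Restr.okT (transRoles T) T

-- Hilbert's tenth problem over ℕ (the standard undecidable source problem):
-- a Diophantine equation p = q between polynomials with natural coefficients.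

data Poly : Set where
  var  : ℕ → Poly
  cst  : ℕ → Poly
  padd : Poly → Poly → Poly
  pmul : Poly → Poly → Poly

evalP : (ℕ → ℕ) → Poly → ℕ
evalP ρ (var i) = ρ i
evalP ρ (cst n) = n
evalP ρ (padd p q) = evalP ρ p + evalP ρ q
evalP ρ (pmul p q) = evalP ρ p * evalP ρ q

Diophantine : Set
Diophantine = Poly × Poly

Solvable : Diophantine → Set
Solvable (p , q) = ∃ λ (ρ : ℕ → ℕ) → evalP ρ p ≡ evalP ρ q

{-# OPTIONS --safe #-}
module Submission where

-- A Diophantine equation is turned into a nondeterministic register machine
-- whose transitions are linear: each product z = x · y is computed by a
-- countdown that starts with i = x, r = z and subtracts 1 from i and y from r
-- at every step until i = 0, where r = 0 is required.
--
-- Runs of such a machine are forced in models as follows.  Chain elements are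
-- labelled alternately by two concept names, and two transitive roles
-- alternate between "current" and "next".  Two consecutive chain elements see
-- each other through the role between them, so by transitivity they have the
-- same successors for that role; a register value is the number of those
-- successors satisfying a given concept name.  Seeing each other is enforced by
-- cardinalities 1: every element sees exactly one anchor through a further
-- transitive role, so an anchor sees itself, and loops are passed on along the
-- chain that starts there.

open import Defs
open import Data.Bool using (Bool; true; false; _∧_; _∨_; not; if_then_else_)
open import Data.Bool.Properties using (T-≡; T?; ∨-zeroʳ) renaming (_≟_ to _≟ᵇ_)
open import Data.Empty using (⊥-elim)
open import Data.List using (List; []; _∷_; _++_; map; replicate; length; upTo; filter; deduplicate)
open import Data.List.Membership.Propositional using (_∈_)
open import Data.List.Membership.Propositional.Properties
open import Data.List.Properties using (map-++; length-map; length-upTo)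
open import Data.List.Relation.Unary.All using ([]; _∷_; lookup)
open import Data.List.Relation.Unary.AllPairs using ([]; _∷_)
open import Data.List.Relation.Unary.Any using (here; there)
open import Data.List.Relation.Unary.Unique.Propositional using (Unique)
import Data.List.Relation.Unary.Unique.DecPropositional.Properties as DecUnique
import Data.List.Relation.Unary.Unique.Propositional.Properties as Unique
open import Data.Nat using (ℕ; zero; suc; pred; _+_; _*_; _∸_; _≤_; _<_; z≤n; s≤s; s≤s⁻¹; _⊔_; _≡ᵇ_; _<ᵇ_)
open import Data.Nat.GeneralisedArithmetic using (fold)
open import Data.Nat.ListAction using (sum)
open import Data.Nat.ListAction.Properties using (sum-++)
open import Data.Nat.Properties
open import Data.Product using (Σ; ∃; _×_; _,_; proj₁; proj₂)
open import Data.Product.Properties using (≡-dec; ,-injectiveʳ)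
open import Data.Sum using (_⊎_; inj₁; inj₂)
open import Data.Unit using (⊤; tt)
open import Function using (_∘_)
open import Function.Bundles using (_⇔_; mk⇔; module Equivalence)
open import Relation.Binary.Definitions using (DecidableEquality)
open import Relation.Binary.PropositionalEquality using (_≡_; _≢_; refl; sym; cong; cong₂; subst; module ≡-Reasoning) renaming (trans to ≡-trans)
open import Relation.Nullary using (¬_)

-- Linear transition systems

data Term : Set where
  one : Term
  cur : ℕ → Term
  nxt : ℕ → Term

-- Sums are lists with repetition: a constant n becomes n copies of `one`, so the cardinality
-- constraints built from them need no constants other than 0 and 1.
data Formula : Set where
  _≐_ : List Term → List Term → Formula
  ⊤′  : Formula
  _∧′_ _∨′_ : Formula → Formula → Formula

infix 6 _≐_
infixr 5 _∧′_
infixr 4 _∨′_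

⟦_⟧t : Term → (ℕ → ℕ) → (ℕ → ℕ) → ℕ
⟦ one ⟧t   u v = 1
⟦ cur c ⟧t u v = u c
⟦ nxt c ⟧t u v = v c

⟦_⟧l : List Term → (ℕ → ℕ) → (ℕ → ℕ) → ℕ
⟦ l ⟧l u v = sum (map (λ τ → ⟦ τ ⟧t u v) l)

_,_⊨_ : (ℕ → ℕ) → (ℕ → ℕ) → Formula → Set
u , v ⊨ (l ≐ l′)  = ⟦ l ⟧l u v ≡ ⟦ l′ ⟧l u v
u , v ⊨ ⊤′        = ⊤
u , v ⊨ (φ ∧′ ψ) = u , v ⊨ φ × u , v ⊨ ψ
u , v ⊨ (φ ∨′ ψ) = u , v ⊨ φ ⊎ u , v ⊨ ψ

infix 3 _,_⊨_

record IsRun (φ ψ : Formula) (w : ℕ → ℕ → ℕ) : Set where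
  field
    initial : w 0 , w 1 ⊨ φ
    steps   : ∀ t → w t , w (suc t) ⊨ ψ

-- Polynomials as linear transition systems

even : ℕ → ℕ
even zero    = zero
even (suc n) = suc (suc (even n))

odd : ℕ → ℕ
odd n = suc (even n)

interleave : (ℕ → ℕ) → (ℕ → ℕ) → ℕ → ℕ
interleave f g zero    = f zero
interleave f g (suc n) = interleave g (f ∘ suc) n

interleave-even : ∀ f g n → interleave f g (even n) ≡ f n
interleave-even f g zero    = refl
interleave-even f g (suc n) = interleave-even (f ∘ suc) (g ∘ suc) n

interleave-odd : ∀ f g n → interleave f g (odd n) ≡ g n
interleave-odd f g n = interleave-even g (f ∘ suc) n

-- The argument k names the registers belonging to a subterm; the even
-- registers are reserved for the variables of the equation.
linear : (ℕ → Term) → Poly → (ℕ → ℕ) → List Term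
linear f (var i)    k = f (even i) ∷ []
linear f (cst n)    k = replicate n one
linear f (padd p q) k = linear f p (k ∘ even) ++ linear f q (k ∘ odd)
linear f (pmul p q) k = f (k 0) ∷ []

left right : (ℕ → ℕ) → ℕ → ℕ
left  k n = k (3 + even n)
right k n = k (3 + odd n)

-- For a product, k 0 holds its value, k 1 the countdown and k 2 the remainder.
start : Poly → (ℕ → ℕ) → Formula
start (var i)    k = ⊤′
start (cst n)    k = ⊤′
start (padd p q) k = start p (k ∘ even) ∧′ start q (k ∘ odd)
start (pmul p q) k =
  start p (left k) ∧′ start q (right k)
  ∧′ (cur (k 1) ∷ []) ≐ linear cur p (left k)
  ∧′ (cur (k 2) ∷ []) ≐ (cur (k 0) ∷ [])

-- The first disjunct leaves the next values free, so a run can continue forever after the countdown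
-- has ended. With `i` at 0 and `r` nonzero neither disjunct holds; with `i` positive only the
-- second can.
countdown : ℕ → ℕ → List Term → Formula
countdown i r y =
    (cur i ∷ []) ≐ []                   ∧′ (cur r ∷ []) ≐ []
  ∨′ (cur i ∷ []) ≐ (one ∷ nxt i ∷ []) ∧′ (cur r ∷ []) ≐ (nxt r ∷ y)

step : Poly → (ℕ → ℕ) → Formula
step (var i)    k = ⊤′
step (cst n)    k = ⊤′
step (padd p q) k = step p (k ∘ even) ∧′ step q (k ∘ odd)
step (pmul p q) k =
  step p (left k) ∧′ step q (right k)
  ∧′ linear cur q (right k) ≐ linear nxt q (right k)
  ∧′ countdown (k 1) (k 2) (linear cur q (right k))

-- Treating the two sides as a sum gives them disjoint registers, and the naming `odd` keeps these
-- apart from the registers of the variables.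
initialFormula stepFormula : Diophantine → Formula
initialFormula (p , q) =
  start (padd p q) odd ∧′ linear cur p (odd ∘ even) ≐ linear cur q (odd ∘ odd)
stepFormula (p , q) = step (padd p q) odd

-- Runs compute polynomial values

linearValue : Poly → (ℕ → ℕ) → (ℕ → ℕ) → ℕ
linearValue (var i)    k u = u (even i)
linearValue (cst n)    k u = n
linearValue (padd p q) k u = linearValue p (k ∘ even) u + linearValue q (k ∘ odd) u
linearValue (pmul p q) k u = u (k 0)

⟦linear⟧ : ∀ f u v v′ → (∀ c → ⟦ f c ⟧t u v ≡ v′ c) →
           ∀ p k → ⟦ linear f p k ⟧l u v ≡ linearValue p k v′
⟦linear⟧ f u v v′ f≡ (var i) k = ≡-trans (+-identityʳ _) (f≡ (even i))
⟦linear⟧ f u v v′ f≡ (cst n) k = ones n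
  where
  ones : ∀ n → ⟦ replicate n one ⟧l u v ≡ n
  ones zero    = refl
  ones (suc n) = cong suc (ones n)
⟦linear⟧ f u v v′ f≡ (padd p q) k = begin
  ⟦ lp ++ lq ⟧l u v        ≡⟨ cong sum (map-++ (λ τ → ⟦ τ ⟧t u v) lp lq) ⟩
  sum (map (λ τ → ⟦ τ ⟧t u v) lp ++ map (λ τ → ⟦ τ ⟧t u v) lq)
                           ≡⟨ sum-++ (map (λ τ → ⟦ τ ⟧t u v) lp) _ ⟩
  ⟦ lp ⟧l u v + ⟦ lq ⟧l u v ≡⟨ cong₂ _+_ (⟦linear⟧ f u v v′ f≡ p (k ∘ even)) (⟦linear⟧ f u v v′ f≡ q (k ∘ odd)) ⟩
  linearValue p (k ∘ even) v′ + linearValue q (k ∘ odd) v′ ∎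
  where
  open ≡-Reasoning
  lp = linear f p (k ∘ even)
  lq = linear f q (k ∘ odd)
⟦linear⟧ f u v v′ f≡ (pmul p q) k = ≡-trans (+-identityʳ _) (f≡ (k 0))

⟦linear-cur⟧ : ∀ u v p k → ⟦ linear cur p k ⟧l u v ≡ linearValue p k u
⟦linear-cur⟧ u v = ⟦linear⟧ cur u v u (λ _ → refl)

⟦linear-nxt⟧ : ∀ u v p k → ⟦ linear nxt p k ⟧l u v ≡ linearValue p k v
⟦linear-nxt⟧ u v = ⟦linear⟧ nxt u v v (λ _ → refl)

-- Induction on the countdown value, for all times at once: a positive value excludes the first
-- alternative, and the second passes to time `suc t` with a value one lower. As `y` is constant,
-- the subtracted amounts add up to a multiple of `y t`.
countdown-product : (i r y : ℕ → ℕ) → (∀ t → y t ≡ y (suc t)) →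
  (∀ t → (i t ≡ 0 × r t ≡ 0) ⊎ (i t ≡ suc (i (suc t)) × r t ≡ r (suc t) + y t)) →
  ∀ n t → i t ≡ n → r t ≡ n * y t
countdown-product i r y y-const down zero t i≡n with down t
... | inj₁ (_ , r≡0) = r≡0
... | inj₂ (i≡ , _)  = ⊥-elim (0≢1+n (≡-trans (sym i≡n) i≡))
countdown-product i r y y-const down (suc n) t i≡n with down t
... | inj₁ (i≡0 , _) = ⊥-elim (0≢1+n (≡-trans (sym i≡0) i≡n))
... | inj₂ (i≡ , r≡) = begin
  r t                      ≡⟨ r≡ ⟩
  r (suc t) + y t          ≡⟨ cong (_+ y t) (countdown-product i r y y-const down n (suc t) (suc-injective (≡-trans (sym i≡) i≡n))) ⟩
  n * y (suc t) + y t      ≡⟨ cong (λ z → n * z + y t) (y-const t) ⟨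
  n * y t + y t            ≡⟨ +-comm (n * y t) (y t) ⟩
  suc n * y t              ∎
  where open ≡-Reasoning

-- Only time 0 is evaluated. The variable registers may change later; what the steps freeze is the
-- value of the second factor of each product, and this is the constancy that `countdown-product`
-- asks for.
run-evaluates : ∀ (w : ℕ → ℕ → ℕ) p k → IsRun (start p k) (step p k) w →
                linearValue p k (w 0) ≡ evalP (w 0 ∘ even) p
run-evaluates w (var i)    k run = refl
run-evaluates w (cst n)    k run = refl
run-evaluates w (padd p q) k run = cong₂ _+_
  (run-evaluates w p (k ∘ even) (record { initial = proj₁ initial ; steps = proj₁ ∘ steps }))
  (run-evaluates w q (k ∘ odd)  (record { initial = proj₂ initial ; steps = proj₂ ∘ steps }))
  where open IsRun run
run-evaluates w (pmul p q) k run = begin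
  -- One-term sums end in `+ 0`, which is cancelled here and below.
  w 0 (k 0)             ≡⟨ +-cancelʳ-≡ 0 _ _ (proj₂ (proj₂ (proj₂ initial))) ⟨
  w 0 (k 2)             ≡⟨ countdown-product (λ t → w t (k 1)) (λ t → w t (k 2)) y y-const down _ 0 refl ⟩
  w 0 (k 1) * y 0       ≡⟨ cong₂ _*_ i≡ (run-evaluates w q (right k) (record { initial = proj₁ (proj₂ initial) ; steps = proj₁ ∘ proj₂ ∘ steps })) ⟩
  evalP (w 0 ∘ even) p * evalP (w 0 ∘ even) q ∎
  where
  open IsRun run
  open ≡-Reasoning
  y : ℕ → ℕ
  y t = linearValue q (right k) (w t)
  y-const : ∀ t → y t ≡ y (suc t)
  y-const t = begin
    y t        ≡⟨ ⟦linear-cur⟧ (w t) (w (suc t)) q (right k) ⟨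
    _          ≡⟨ proj₁ (proj₂ (proj₂ (steps t))) ⟩
    _          ≡⟨ ⟦linear-nxt⟧ (w t) (w (suc t)) q (right k) ⟩
    y (suc t)  ∎
  down : ∀ t → (w t (k 1) ≡ 0 × w t (k 2) ≡ 0)
             ⊎ (w t (k 1) ≡ suc (w (suc t) (k 1)) × w t (k 2) ≡ w (suc t) (k 2) + y t)
  down t with proj₂ (proj₂ (proj₂ (steps t)))
  ... | inj₁ (i≡0 , r≡0) = inj₁ (+-cancelʳ-≡ 0 _ _ i≡0 , +-cancelʳ-≡ 0 _ _ r≡0)
  ... | inj₂ (i≡ , r≡)   = inj₂
    ( +-cancelʳ-≡ 0 _ _ i≡
    , (begin
        w t (k 2)      ≡⟨ +-identityʳ _ ⟨
        w t (k 2) + 0  ≡⟨ r≡ ⟩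
        _              ≡⟨ cong (w (suc t) (k 2) +_) (⟦linear-cur⟧ (w t) (w (suc t)) q (right k)) ⟩
        w (suc t) (k 2) + y t ∎))
  i≡ : w 0 (k 1) ≡ evalP (w 0 ∘ even) p
  i≡ = begin
    w 0 (k 1)                    ≡⟨ +-identityʳ _ ⟨
    w 0 (k 1) + 0                ≡⟨ proj₁ (proj₂ (proj₂ initial)) ⟩
    _                            ≡⟨ ⟦linear-cur⟧ (w 0) (w 1) p (left k) ⟩
    linearValue p (left k) (w 0) ≡⟨ run-evaluates w p (left k) (record { initial = proj₁ initial ; steps = proj₁ ∘ steps }) ⟩
    evalP (w 0 ∘ even) p         ∎

-- Solutions yield runs

values : (ℕ → ℕ) → Poly → ℕ → ℕ → ℕ
values ρ (var i)    t n = 0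
values ρ (cst m)    t n = 0
values ρ (padd p q) t n = interleave (values ρ p t) (values ρ q t) n
values ρ (pmul p q) t 0 = evalP ρ p * evalP ρ q
-- Truncated subtraction keeps the countdown at 0 once it is reached, and the remainder is always
-- the countdown times the second factor.
values ρ (pmul p q) t 1 = evalP ρ p ∸ t
values ρ (pmul p q) t 2 = (evalP ρ p ∸ t) * evalP ρ q
values ρ (pmul p q) t (suc (suc (suc n))) = interleave (values ρ p t) (values ρ q t) n

module _ (ρ : ℕ → ℕ) (w : ℕ → ℕ → ℕ) (w-var : ∀ t i → w t (even i) ≡ ρ i) where

  Stores : Poly → (ℕ → ℕ) → Set
  Stores p k = ∀ t n → w t (k n) ≡ values ρ p t n

  stores-even : ∀ p q k → Stores (padd p q) k → Stores p (k ∘ even)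
  stores-even p q k st t n = ≡-trans (st t (even n)) (interleave-even _ _ n)

  stores-odd : ∀ p q k → Stores (padd p q) k → Stores q (k ∘ odd)
  stores-odd p q k st t n = ≡-trans (st t (odd n)) (interleave-odd (values ρ p t) _ n)

  stores-left : ∀ p q k → Stores (pmul p q) k → Stores p (left k)
  stores-left p q k st t n = ≡-trans (st t (3 + even n)) (interleave-even _ _ n)

  stores-right : ∀ p q k → Stores (pmul p q) k → Stores q (right k)
  stores-right p q k st t n = ≡-trans (st t (3 + odd n)) (interleave-odd (values ρ p t) _ n)

  linearValue-evalP : ∀ p k → Stores p k → ∀ t → linearValue p k (w t) ≡ evalP ρ p
  linearValue-evalP (var i)    k st t = w-var t i
  linearValue-evalP (cst n)    k st t = refl
  linearValue-evalP (padd p q) k st t = cong₂ _+_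
    (linearValue-evalP p (k ∘ even) (stores-even p q k st) t)
    (linearValue-evalP q (k ∘ odd)  (stores-odd p q k st) t)
  linearValue-evalP (pmul p q) k st t = st t 0

  cur-evalP : ∀ p k → Stores p k → ∀ t → ⟦ linear cur p k ⟧l (w t) (w (suc t)) ≡ evalP ρ p
  cur-evalP p k st t = ≡-trans (⟦linear-cur⟧ _ _ p k) (linearValue-evalP p k st t)

  nxt-evalP : ∀ p k → Stores p k → ∀ t → ⟦ linear nxt p k ⟧l (w t) (w (suc t)) ≡ evalP ρ p
  nxt-evalP p k st t = ≡-trans (⟦linear-nxt⟧ _ _ p k) (linearValue-evalP p k st (suc t))

  start-holds : ∀ p k → Stores p k → w 0 , w 1 ⊨ start p k
  start-holds (var i)    k st = tt
  start-holds (cst n)    k st = tt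
  start-holds (padd p q) k st =
    start-holds p (k ∘ even) (stores-even p q k st) , start-holds q (k ∘ odd) (stores-odd p q k st)
  start-holds (pmul p q) k st =
    start-holds p (left k) st-l , start-holds q (right k) (stores-right p q k st)
    , ≡-trans (+-identityʳ _) (≡-trans (st 0 1) (sym (cur-evalP p (left k) st-l 0)))
    , cong (_+ 0) (≡-trans (st 0 2) (sym (st 0 0)))
    where st-l = stores-left p q k st

  step-holds : ∀ p k → Stores p k → ∀ t → w t , w (suc t) ⊨ step p k
  step-holds (var i)    k st t = tt
  step-holds (cst n)    k st t = tt
  step-holds (padd p q) k st t =
    step-holds p (k ∘ even) (stores-even p q k st) t , step-holds q (k ∘ odd) (stores-odd p q k st) t
  step-holds (pmul p q) k st t =
    step-holds p (left k) (stores-left p q k st) t , step-holds q (right k) st-r t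
    , ≡-trans (cur-evalP q (right k) st-r t) (sym (nxt-evalP q (right k) st-r t))
    , down (evalP ρ p ∸ t) refl
    where
    open ≡-Reasoning
    st-r = stores-right p q k st
    Q = evalP ρ q
    -- The intended countdown value selects the disjunct: 0 the first, a successor the second.
    down : ∀ i → evalP ρ p ∸ t ≡ i → w t , w (suc t) ⊨ countdown (k 1) (k 2) (linear cur q (right k))
    down zero i≡ = inj₁
      ( ≡-trans (+-identityʳ _) (≡-trans (st t 1) i≡)
      , ≡-trans (+-identityʳ _) (≡-trans (st t 2) (cong (_* Q) i≡)))
    down (suc i) i≡ = inj₂
      ( (begin
          w t (k 1) + 0               ≡⟨ +-identityʳ _ ⟩
          w t (k 1)                   ≡⟨ ≡-trans (st t 1) i≡ ⟩
          suc i                       ≡⟨ cong suc (≡-trans (st (suc t) 1) i′≡) ⟨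
          suc (w (suc t) (k 1))       ≡⟨ cong suc (+-identityʳ _) ⟨
          suc (w (suc t) (k 1) + 0)   ∎)
      , (begin
          w t (k 2) + 0               ≡⟨ +-identityʳ _ ⟩
          w t (k 2)                   ≡⟨ ≡-trans (st t 2) (cong (_* Q) i≡) ⟩
          Q + i * Q                   ≡⟨ +-comm Q (i * Q) ⟩
          i * Q + Q                   ≡⟨ cong₂ _+_ (≡-trans (st (suc t) 2) (cong (_* Q) i′≡)) (cur-evalP q (right k) st-r t) ⟨
          w (suc t) (k 2) + ⟦ linear cur q (right k) ⟧l (w t) (w (suc t)) ∎))
      where
      i′≡ : evalP ρ p ∸ suc t ≡ i
      i′≡ = ≡-trans (sym (pred[m∸n]≡m∸[1+n] (evalP ρ p) t)) (cong pred i≡)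

-- Solvability as existence of a run

HasRun : Formula → Formula → Set
HasRun φ ψ = ∃ (IsRun φ ψ)

iterated-run : ∀ {φ ψ} {S : Set} (contents : S → ℕ → ℕ) (next : S → S) (s : S) →
  contents s , contents (next s) ⊨ φ → (∀ s → contents s , contents (next s) ⊨ ψ) → HasRun φ ψ
iterated-run contents next s init step =
  contents ∘ fold s next , record { initial = init ; steps = step ∘ fold s next }

solvable⇒run : ∀ e → Solvable e → HasRun (initialFormula e) (stepFormula e)
solvable⇒run (p , q) (ρ , p≡q) = w , record
  { initial = start-holds ρ w w-var (padd p q) odd st
            , ≡-trans (cur-evalP ρ w w-var p _ (stores-even ρ w w-var p q odd st) 0)
                (≡-trans p≡q (sym (cur-evalP ρ w w-var q _ (stores-odd ρ w w-var p q odd st) 0)))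
  ; steps = step-holds ρ w w-var (padd p q) odd st }
  where
  -- The variables stay constant in the even registers; the working registers are the odd ones,
  -- matching the naming in `initialFormula`.
  w : ℕ → ℕ → ℕ
  w t = interleave ρ (values ρ (padd p q) t)
  w-var : ∀ t i → w t (even i) ≡ ρ i
  w-var t i = interleave-even ρ _ i
  st : Stores ρ w w-var (padd p q) odd
  st t n = interleave-odd ρ _ n

run⇒solvable : ∀ e → HasRun (initialFormula e) (stepFormula e) → Solvable e
run⇒solvable (p , q) (w , run) = w 0 ∘ even , (begin
  evalP (w 0 ∘ even) p              ≡⟨ run-evaluates w p (odd ∘ even) (record { initial = proj₁ (proj₁ initial) ; steps = proj₁ ∘ steps }) ⟨
  linearValue p (odd ∘ even) (w 0)  ≡⟨ ⟦linear-cur⟧ (w 0) (w 1) p _ ⟨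
  _                                 ≡⟨ proj₂ initial ⟩
  _                                 ≡⟨ ⟦linear-cur⟧ (w 0) (w 1) q _ ⟩
  linearValue q (odd ∘ odd) (w 0)   ≡⟨ run-evaluates w q (odd ∘ odd) (record { initial = proj₂ (proj₁ initial) ; steps = proj₂ ∘ steps }) ⟩
  evalP (w 0 ∘ even) q              ∎)
  where
  open IsRun run
  open ≡-Reasoning

-- Counting successors

∧⁻ : ∀ x {y} → x ∧ y ≡ true → x ≡ true × y ≡ true
∧⁻ true y≡ = refl , y≡

∧⁺ : ∀ {x y} → x ≡ true → y ≡ true → x ∧ y ≡ true
∧⁺ refl y≡ = y≡

∨⁻ : ∀ x {y} → x ∨ y ≡ true → x ≡ true ⊎ y ≡ true
∨⁻ true  _  = inj₁ refl
∨⁻ false y≡ = inj₂ y≡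

∨⁺ˡ : ∀ {x y} → x ≡ true → x ∨ y ≡ true
∨⁺ˡ refl = refl

∨⁺ʳ : ∀ {x y} → y ≡ true → x ∨ y ≡ true
∨⁺ʳ {x} refl = ∨-zeroʳ x

≡ᵇ⁻ : ∀ {m n} → (m ≡ᵇ n) ≡ true → m ≡ n
≡ᵇ⁻ {m} {n} = ≡ᵇ⇒≡ m n ∘ Equivalence.from T-≡

≡ᵇ⁺ : ∀ {m n} → m ≡ n → (m ≡ᵇ n) ≡ true
≡ᵇ⁺ {m} {n} = Equivalence.to T-≡ ∘ ≡⇒≡ᵇ m n

module Counting (I : Interp) where
  open Interp I
  open Sem I

  count-++-∷ : ∀ s d xs {y ys} → ⟦ s ⟧s d y ≡ true →
               count s d (xs ++ y ∷ ys) ≡ suc (count s d (xs ++ ys))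
  count-++-∷ s d [] y∈s rewrite y∈s = refl
  count-++-∷ s d (x ∷ xs) y∈s =
    ≡-trans (cong ((if ⟦ s ⟧s d x then 1 else 0) +_) (count-++-∷ s d xs y∈s)) (+-suc (if ⟦ s ⟧s d x then 1 else 0) _)

  -- Each counted element of `xs` is cut out of `ys`; as `xs` has no duplicates, the later ones
  -- survive in what is left. The base points differ so that successors of two chain elements can be
  -- compared.
  count-≤ : ∀ s d t d′ {xs ys} → Unique xs →
            (∀ e → e ∈ xs → ⟦ s ⟧s d e ≡ true → e ∈ ys × ⟦ t ⟧s d′ e ≡ true) →
            count s d xs ≤ count t d′ ys
  count-≤ s d t d′ [] xs⊆ys = z≤n
  count-≤ s d t d′ {x ∷ xs} (x∉xs ∷ xs!) xs⊆ys with ⟦ s ⟧s d x in x∈s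
  ... | false = count-≤ s d t d′ xs! (λ e e∈xs → xs⊆ys e (there e∈xs))
  ... | true with xs⊆ys x (here refl) x∈s
  ...   | x∈ys , x∈t with ∈-∃++ x∈ys
  ...     | as , bs , refl = ≤-trans
    (s≤s (count-≤ s d t d′ xs! (λ e e∈xs e∈s →
      let e∈ys , e∈t = xs⊆ys e (there e∈xs) e∈s in remove (lookup x∉xs e∈xs) (∈-++⁻ as e∈ys) , e∈t)))
    (≤-reflexive (sym (count-++-∷ t d′ as x∈t)))
    where
    remove : ∀ {e} → x ≢ e → e ∈ as ⊎ e ∈ x ∷ bs → e ∈ as ++ bs
    remove x≢e (inj₁ e∈as)         = ∈-++⁺ˡ e∈as
    remove x≢e (inj₂ (here refl))  = ⊥-elim (x≢e refl)
    remove x≢e (inj₂ (there e∈bs)) = ∈-++⁺ʳ as e∈bs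

  count-witness : ∀ s d xs {n} → count s d xs ≡ suc n → ∃ λ e → e ∈ xs × ⟦ s ⟧s d e ≡ true
  count-witness s d (x ∷ xs) c≡ with ⟦ s ⟧s d x in x∈s
  ... | true  = x , here refl , x∈s
  ... | false = let e , e∈xs , e∈s = count-witness s d xs c≡ in e , there e∈xs , e∈s

  count-≢0 : ∀ s d {xs e} → e ∈ xs → ⟦ s ⟧s d e ≡ true → count s d xs ≢ 0
  count-≢0 s d (here refl) e∈s c≡0 rewrite e∈s = 1+n≢0 c≡0
  count-≢0 s d {x ∷ xs} (there e∈xs) e∈s c≡0 =
    count-≢0 s d e∈xs e∈s (m+n≡0⇒n≡0 (if ⟦ s ⟧s d x then 1 else 0) c≡0)

  count-unique : ∀ s d {xs e e′} → count s d xs ≡ 1 → e ∈ xs → e′ ∈ xs →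
                 ⟦ s ⟧s d e ≡ true → ⟦ s ⟧s d e′ ≡ true → e ≡ e′
  count-unique s d c≡1 (here refl) (here refl) e∈s e′∈s = refl
  count-unique s d c≡1 (here refl) (there e′∈) e∈s e′∈s rewrite e∈s =
    ⊥-elim (count-≢0 s d e′∈ e′∈s (suc-injective c≡1))
  count-unique s d c≡1 (there e∈) (here refl) e∈s e′∈s rewrite e′∈s =
    ⊥-elim (count-≢0 s d e∈ e∈s (suc-injective c≡1))
  count-unique s d {x ∷ xs} c≡1 (there e∈) (there e′∈) e∈s e′∈s with ⟦ s ⟧s d x
  ... | false = count-unique s d c≡1 e∈ e′∈ e∈s e′∈s
  ... | true  = ⊥-elim (count-≢0 s d e∈ e∈s (suc-injective c≡1))

  count-univ : ∀ d xs → count univ d xs ≡ length xs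
  count-univ d []       = refl
  count-univ d (x ∷ xs) = cong suc (count-univ d xs)

  ∣_∣at_ : SetTerm → Δ → ℕ
  ∣ s ∣at d = count s d (ars d)

  -- Counting `univ` over `ys` gives its length, so two applications of `count-≤` suffice.
  count-list : ∀ s d ys → Unique ys → (∀ e → e ∈ ars d → ⟦ s ⟧s d e ≡ true → e ∈ ys) →
               (∀ e → e ∈ ys → e ∈ ars d × ⟦ s ⟧s d e ≡ true) → ∣ s ∣at d ≡ length ys
  count-list s d ys ys! s⊆ys ys⊆s = ≡-trans
    (≤-antisym (count-≤ s d univ d (ars-unique d) (λ e e∈ e∈s → s⊆ys e e∈ e∈s , refl))
               (count-≤ univ d s d ys! (λ e e∈ys _ → ys⊆s e e∈ys)))
    (count-univ d ys)

-- The TBox of a transition system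

-- The same number names the cluster role and, among the concept names, the label of the elements
-- that read their current values from it.
roleOf : Bool → ℕ
roleOf false = 0
roleOf true  = 1

anchorRole : ℕ
anchorRole = 2

label : Bool → SetTerm
label b = concept (atom (roleOf b))

anchor : Concept
anchor = atom 2

register : ℕ → SetTerm
register c = concept (atom (3 + c))

top : Concept
top = succ (numeq (pa 0 []) (pa 0 []))

or : Concept → Concept → Concept
or C D = neg (and (neg C) (neg D))

total : List SetTerm → PAExpr
total ss = pa 0 (map (1 ,_) ss)

exactlyOne : SetTerm → Concept
exactlyOne s = succ (numeq (total (s ∷ [])) (pa 1 []))

-- At an element labelled b the current register values are read off the
-- cluster of roleOf b, the next ones off the cluster of the other role.
termSet : Bool → Term → SetTerm
termSet b one     = inter (role (roleOf (not b))) (label b)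
termSet b (cur c) = inter (role (roleOf b)) (register c)
termSet b (nxt c) = inter (role (roleOf (not b))) (register c)

formulaConcept : Bool → Formula → Concept
formulaConcept b (l ≐ l′)  = succ (numeq (total (map (termSet b) l)) (total (map (termSet b) l′)))
formulaConcept b ⊤′        = top
formulaConcept b (φ ∧′ ψ) = and (formulaConcept b φ) (formulaConcept b ψ)
formulaConcept b (φ ∨′ ψ) = or (formulaConcept b φ) (formulaConcept b ψ)

-- An r-loop at an element labelled b forces an r′-loop: both cardinalities
-- being 1, the unique r′-successor labelled b is the element itself.
link : ℕ → ℕ → Bool → Concept
link r r′ b = and (exactlyOne (inter (union (role r) (role r′)) (label b)))
                  (exactlyOne (inter (role r′) (label b)))

-- The nested cardinality lets the successor see its predecessor back, which
-- makes the two share one cluster.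
advance : Bool → Concept
advance b = exactlyOne
  (inter (inter (role out) (label (not b))) (concept (exactlyOne (inter (role out) (label b)))))
  where out = roleOf (not b)

stepAxiom : Formula → Bool → Axiom
stepAxiom ψ b = ci (atom (roleOf b))
  (and (link (roleOf b) (roleOf (not b)) b) (and (advance b) (formulaConcept b ψ)))

-- Role r is made extensionally equal to the transitive role 3 + r, so that r
-- may occur in numerical constraints.
alias : ℕ → Axiom
alias r = ci top (succ (seteq (role r) (role (3 + r))))

-- As the domain is nonempty, the axiom on `anchorRole` produces an anchor. Its loop becomes a loop
-- for role 0, from which the chain starts. The transitivity axioms mention only 3, 4 and 5, so the
-- cardinalities may use 0, 1 and 2.
encode : Formula → Formula → TBox
encode φ ψ =
  trans 3 ∷ trans 4 ∷ trans 5 ∷ alias 0 ∷ alias 1 ∷ alias 2 ∷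
  ci top (exactlyOne (inter (role anchorRole) (concept anchor))) ∷
  ci anchor (and (atom 0) (and (link anchorRole 0 false) (formulaConcept false φ))) ∷
  stepAxiom ψ false ∷ stepAxiom ψ true ∷ []

-- The encoding meets the syntactic restriction

module _ where
  open Restr (3 ∷ 4 ∷ 5 ∷ [])

  termSet-noTr : ∀ b τ → noTr (termSet b τ) ≡ true
  termSet-noTr false one     = refl
  termSet-noTr false (cur c) = refl
  termSet-noTr false (nxt c) = refl
  termSet-noTr true  one     = refl
  termSet-noTr true  (cur c) = refl
  termSet-noTr true  (nxt c) = refl

  termSet-okS : ∀ b τ → okS (termSet b τ) ≡ true
  termSet-okS b one     = refl
  termSet-okS b (cur c) = refl
  termSet-okS b (nxt c) = refl

  total-okE : ∀ b l → okE (total (map (termSet b) l)) ≡ true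
  total-okE b []      = refl
  total-okE b (τ ∷ l) = ∧⁺ (termSet-noTr b τ) (∧⁺ (termSet-okS b τ) (total-okE b l))

  formulaConcept-okC : ∀ b φ → okC (formulaConcept b φ) ≡ true
  formulaConcept-okC b (l ≐ l′)  = ∧⁺ (total-okE b l) (total-okE b l′)
  formulaConcept-okC b ⊤′        = refl
  formulaConcept-okC b (φ ∧′ ψ) = ∧⁺ (formulaConcept-okC b φ) (formulaConcept-okC b ψ)
  formulaConcept-okC b (φ ∨′ ψ) = ∧⁺ (formulaConcept-okC b φ) (formulaConcept-okC b ψ)

-- `transRoles` reduces to the list 3, 4, 5 fixed above. Apart from the concepts of `φ` and `ψ`,
-- everything is settled by evaluation.
encode-restricted : ∀ φ ψ → Restricted (encode φ ψ) ≡ true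
encode-restricted φ ψ
  rewrite formulaConcept-okC false φ | formulaConcept-okC false ψ | formulaConcept-okC true ψ = refl

-- Truth of formulas and of their concepts

boundTerm : Term → ℕ
boundTerm one     = 0
boundTerm (cur c) = suc c
boundTerm (nxt c) = suc c

boundList : List Term → ℕ
boundList []      = 0
boundList (τ ∷ l) = boundTerm τ ⊔ boundList l

-- Registers of the formula lie strictly below this number. The model of a run represents only such
-- registers, since the values of all registers at one time may be unbounded and a cluster is
-- finite.
bound : Formula → ℕ
bound (l ≐ l′)  = boundList l ⊔ boundList l′
bound ⊤′        = 0
bound (φ ∧′ ψ) = bound φ ⊔ bound ψ
bound (φ ∨′ ψ) = bound φ ⊔ bound ψ

module Formulas (I : Interp) where
  open Interp I
  open Sem I
  open Counting I

  ⟦total⟧ : ∀ ss x → ⟦ total ss ⟧e x ≡ sum (map (λ s → ∣ s ∣at x) ss)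
  ⟦total⟧ []       x = refl
  ⟦total⟧ (s ∷ ss) x = cong₂ _+_ (+-identityʳ _) (⟦total⟧ ss x)

  exactlyOne⁻ : ∀ s x → ⟦ exactlyOne s ⟧c x ≡ true → ∣ s ∣at x ≡ 1
  exactlyOne⁻ s x h = ≡-trans (sym (+-identityʳ _)) (≡-trans (sym (⟦total⟧ (s ∷ []) x)) (≡ᵇ⁻ h))

  exactlyOne⁺ : ∀ s x → ∣ s ∣at x ≡ 1 → ⟦ exactlyOne s ⟧c x ≡ true
  exactlyOne⁺ s x h = ≡ᵇ⁺ (≡-trans (⟦total⟧ (s ∷ []) x) (≡-trans (+-identityʳ _) h))

  or⁻ : ∀ C D x → ⟦ or C D ⟧c x ≡ true → ⟦ C ⟧c x ≡ true ⊎ ⟦ D ⟧c x ≡ true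
  or⁻ C D x h with ⟦ C ⟧c x | ⟦ D ⟧c x
  ... | true  | _    = inj₁ refl
  ... | false | true = inj₂ refl

  or⁺ : ∀ C D x → ⟦ C ⟧c x ≡ true ⊎ ⟦ D ⟧c x ≡ true → ⟦ or C D ⟧c x ≡ true
  or⁺ C D x (inj₁ h) rewrite h = refl
  or⁺ C D x (inj₂ h) with ⟦ C ⟧c x
  ... | true           = refl
  ... | false rewrite h = refl

  -- Used in both directions: for a given model, `u` is defined by the cardinalities at `x`; for a
  -- given run, `u` and `v` are its contents at consecutive times.
  module _ (b : Bool) (x : Δ) (u v : ℕ → ℕ) (B : ℕ)
           (∣one∣ : ∣ termSet b one ∣at x ≡ 1)
           (∣cur∣ : ∀ c → c < B → ∣ termSet b (cur c) ∣at x ≡ u c)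
           (∣nxt∣ : ∀ c → c < B → ∣ termSet b (nxt c) ∣at x ≡ v c) where

    ∣termSet∣ : ∀ τ → boundTerm τ ≤ B → ∣ termSet b τ ∣at x ≡ ⟦ τ ⟧t u v
    ∣termSet∣ one     _   = ∣one∣
    ∣termSet∣ (cur c) c<B = ∣cur∣ c c<B
    ∣termSet∣ (nxt c) c<B = ∣nxt∣ c c<B

    ⟦total-termSet⟧ : ∀ l → boundList l ≤ B → ⟦ total (map (termSet b) l) ⟧e x ≡ ⟦ l ⟧l u v
    ⟦total-termSet⟧ []      _ = refl
    ⟦total-termSet⟧ (τ ∷ l) h = cong₂ _+_
      (≡-trans (+-identityʳ _) (∣termSet∣ τ (m⊔n≤o⇒m≤o (boundTerm τ) _ h)))
      (⟦total-termSet⟧ l (m⊔n≤o⇒n≤o (boundTerm τ) _ h))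

    formulaConcept⁻ : ∀ φ → bound φ ≤ B → ⟦ formulaConcept b φ ⟧c x ≡ true → u , v ⊨ φ
    formulaConcept⁻ (l ≐ l′) h t = ≡-trans (sym (⟦total-termSet⟧ l (m⊔n≤o⇒m≤o (boundList l) _ h)))
      (≡-trans (≡ᵇ⁻ t) (⟦total-termSet⟧ l′ (m⊔n≤o⇒n≤o (boundList l) _ h)))
    formulaConcept⁻ ⊤′ h t = tt
    formulaConcept⁻ (φ ∧′ ψ) h t =
      formulaConcept⁻ φ (m⊔n≤o⇒m≤o (bound φ) _ h) (proj₁ (∧⁻ _ t)) ,
      formulaConcept⁻ ψ (m⊔n≤o⇒n≤o (bound φ) _ h) (proj₂ (∧⁻ (⟦ formulaConcept b φ ⟧c x) t))
    formulaConcept⁻ (φ ∨′ ψ) h t with or⁻ (formulaConcept b φ) (formulaConcept b ψ) x t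
    ... | inj₁ t′ = inj₁ (formulaConcept⁻ φ (m⊔n≤o⇒m≤o (bound φ) _ h) t′)
    ... | inj₂ t′ = inj₂ (formulaConcept⁻ ψ (m⊔n≤o⇒n≤o (bound φ) _ h) t′)

    formulaConcept⁺ : ∀ φ → bound φ ≤ B → u , v ⊨ φ → ⟦ formulaConcept b φ ⟧c x ≡ true
    formulaConcept⁺ (l ≐ l′) h t = ≡ᵇ⁺ (≡-trans (⟦total-termSet⟧ l (m⊔n≤o⇒m≤o (boundList l) _ h))
      (≡-trans t (sym (⟦total-termSet⟧ l′ (m⊔n≤o⇒n≤o (boundList l) _ h)))))
    formulaConcept⁺ ⊤′ h t = refl
    formulaConcept⁺ (φ ∧′ ψ) h (t , t′) = ∧⁺
      (formulaConcept⁺ φ (m⊔n≤o⇒m≤o (bound φ) _ h) t)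
      (formulaConcept⁺ ψ (m⊔n≤o⇒n≤o (bound φ) _ h) t′)
    formulaConcept⁺ (φ ∨′ ψ) h (inj₁ t) = or⁺ (formulaConcept b φ) (formulaConcept b ψ) x
      (inj₁ (formulaConcept⁺ φ (m⊔n≤o⇒m≤o (bound φ) _ h) t))
    formulaConcept⁺ (φ ∨′ ψ) h (inj₂ t) = or⁺ (formulaConcept b φ) (formulaConcept b ψ) x
      (inj₂ (formulaConcept⁺ ψ (m⊔n≤o⇒n≤o (bound φ) _ h) t))

-- From a model to a run

module Chain (I : Interp) (φ ψ : Formula) (model : Sem.IsModel I (encode φ ψ)) where
  open Interp I
  open Sem I
  open Counting I
  open Formulas I

  incl⁻ : ∀ s t d {xs e} → incl s t d xs ≡ true → e ∈ xs → ⟦ s ⟧s d e ≡ true → ⟦ t ⟧s d e ≡ true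
  incl⁻ s t d h (here {x} refl) e∈s with ⟦ s ⟧s d x | ⟦ t ⟧s d x | h
  incl⁻ s t d h (here {x} refl) refl | true | true | _ = refl
  incl⁻ s t d {x ∷ xs} h (there e∈) e∈s = incl⁻ s t d (proj₂ (∧⁻ (not (⟦ s ⟧s d x) ∨ ⟦ t ⟧s d x) h)) e∈ e∈s

  alias-transitive : ∀ r → Satisfies (alias r) → Transitive (3 + r) → Transitive r
  alias-transitive r al tr x y z xy yz =
    incl⁻ (role (3 + r)) (role r) x (proj₂ (∧⁻ (incl (role r) (role (3 + r)) x (ars x)) (al x refl))) (ars-complete (3 + r) x z xz) xz
    where
    to-transitive : ∀ x y → rol r x y ≡ true → rol (3 + r) x y ≡ true
    to-transitive x y xy = incl⁻ (role r) (role (3 + r)) x (proj₁ (∧⁻ _ (al x refl))) (ars-complete r x y xy) xy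
    xz = tr x y z (to-transitive x y xy) (to-transitive y z yz)

  roleOf-transitive : ∀ b → Transitive (roleOf b)
  roleOf-transitive false = alias-transitive 0 (model _ (there (there (there (here refl))))) (model _ (here refl))
  roleOf-transitive true  = alias-transitive 1 (model _ (there (there (there (there (here refl)))))) (model _ (there (here refl)))

  anchor-transitive : Transitive anchorRole
  anchor-transitive = alias-transitive 2 (model _ (there (there (there (there (there (here refl)))))))
    (model _ (there (there (here refl))))

  sees-anchor : ∀ x → ∣ inter (role anchorRole) (concept anchor) ∣at x ≡ 1
  sees-anchor x = exactlyOne⁻ _ x (model _ (there (there (there (there (there (there (here refl))))))) x refl)

  anchor-axiom : Satisfies (ci anchor (and (atom 0) (and (link anchorRole 0 false) (formulaConcept false φ))))
  anchor-axiom = model _ (there (there (there (there (there (there (there (here refl))))))))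

  step-axiom : ∀ b → Satisfies (stepAxiom ψ b)
  step-axiom false = model _ (there (there (there (there (there (there (there (there (here refl)))))))))
  step-axiom true  = model _ (there (there (there (there (there (there (there (there (there (here refl))))))))))

  Labelled : Bool → Δ → Set
  Labelled b x = conc (roleOf b) x ≡ true

  link-loop : ∀ r r′ b x → ⟦ link r r′ b ⟧c x ≡ true → Labelled b x →
              rol r x x ≡ true → rol r′ x x ≡ true
  link-loop r r′ b x h x∈b rxx
    with h₁ , h₂ ← ∧⁻ (⟦ exactlyOne (inter (union (role r) (role r′)) (label b)) ⟧c x) h
    with e , e∈ , he ← count-witness (inter (role r′) (label b)) x (ars x) (exactlyOne⁻ _ x h₂)
    with r′xe , e∈b ← ∧⁻ (rol r′ x e) he
    with refl ← count-unique (inter (union (role r) (role r′)) (label b)) x (exactlyOne⁻ _ x h₁)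
                  (ars-complete r x x rxx) e∈ (∧⁺ (∨⁺ˡ rxx) x∈b) (∧⁺ (∨⁺ʳ {rol r x e} r′xe) e∈b)
    = r′xe

  ∣register∣ : Bool → Δ → ℕ → ℕ
  ∣register∣ b x c = ∣ inter (role (roleOf b)) (register c) ∣at x

  -- By transitivity `y` sees whatever `x` sees. If the two see each other, both inequalities hold
  -- and the register values agree.
  shared-cluster-≤ : ∀ b x y c → rol (roleOf b) y x ≡ true → ∣register∣ b x c ≤ ∣register∣ b y c
  shared-cluster-≤ b x y c yx = count-≤ s x s y (ars-unique x) λ e e∈ he →
    let xe , e∈c = ∧⁻ (rol (roleOf b) x e) he
        ye = roleOf-transitive b y x e yx xe
    in ars-complete _ y e ye , ∧⁺ ye e∈c
    where s = inter (role (roleOf b)) (register c)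

  -- The loop is the invariant that allows the chain to be continued: `link` transfers it to the
  -- other role.
  record State : Set where
    constructor state
    field
      side     : Bool
      node     : Δ
      labelled : Labelled side node
      loop     : rol (roleOf side) node node ≡ true

  open State

  contents : State → ℕ → ℕ
  contents s = ∣register∣ (side s) (node s)

  -- The `y` given by `advance` sees some `e` labelled `b` through the outgoing role, hence so does
  -- `x`. By its transferred loop `x` also sees itself, and it sees only one element labelled `b`,
  -- so `e` is `x`. Thus `x` and `y` see each other and `y` has a loop. The formula is quantified
  -- inside so that the same successor serves `φ` and `ψ`.
  successor : ∀ s → ∃ λ s′ → ∀ χ → ⟦ formulaConcept (side s) χ ⟧c (node s) ≡ true →
              contents s , contents s′ ⊨ χ
  successor (state b x x∈b bxx)
    with h , h′ ← ∧⁻ (⟦ link (roleOf b) (roleOf (not b)) b ⟧c x) (step-axiom b x x∈b)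
    with hadv , _ ← ∧⁻ (⟦ advance b ⟧c x) h′
    with _ , ∣out-b∣ ← ∧⁻ (⟦ exactlyOne (inter (union (role (roleOf b)) (role (roleOf (not b)))) (label b)) ⟧c x) h
    with y , y∈ , hy ← count-witness _ x (ars x) (exactlyOne⁻ _ x hadv)
    with hy′ , hback ← ∧⁻ (rol (roleOf (not b)) x y ∧ conc (roleOf (not b)) y) hy
    with xy , y∈¬b ← ∧⁻ (rol (roleOf (not b)) x y) hy′
    with e , e∈ , he ← count-witness _ y (ars y) (exactlyOne⁻ _ y hback)
    with ye , e∈b ← ∧⁻ (rol (roleOf (not b)) y e) he
    with xx ← link-loop (roleOf b) (roleOf (not b)) b x h x∈b bxx
    with xe ← roleOf-transitive (not b) x y e xy ye
    with refl ← count-unique (inter (role (roleOf (not b))) (label b)) x (exactlyOne⁻ _ x ∣out-b∣)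
                  (ars-complete _ x x xx) (ars-complete _ x e xe) (∧⁺ xx x∈b) (∧⁺ xe e∈b)
    = state (not b) y y∈¬b (roleOf-transitive (not b) y x y ye xy)
    -- The second cardinality of `link` is that of `termSet b one`, which represents the constant 1.
    , λ χ → formulaConcept⁻ b x _ _ (bound χ) (exactlyOne⁻ _ x ∣out-b∣) (λ _ _ → refl)
        (λ c _ → ≤-antisym (shared-cluster-≤ (not b) x y c ye) (shared-cluster-≤ (not b) y x c xy)) χ ≤-refl

  successor-step : ∀ s → contents s , contents (proj₁ (successor s)) ⊨ ψ
  successor-step s = proj₂ (successor s) ψ (holds s)
    where
    holds : ∀ s → ⟦ formulaConcept (side s) ψ ⟧c (node s) ≡ true
    holds (state b x x∈b _) = proj₂ (∧⁻ (⟦ advance b ⟧c x) (proj₂ (∧⁻ (⟦ link (roleOf b) (roleOf (not b)) b ⟧c x) (step-axiom b x x∈b))))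

  run-from : ∀ s → ⟦ formulaConcept (side s) φ ⟧c (node s) ≡ true → HasRun φ ψ
  run-from s h = iterated-run contents (proj₁ ∘ successor) s (proj₂ (successor s) φ h) successor-step

  -- The anchor `a` seen by `elem` sees an anchor `e`, which by transitivity `elem` sees too.
  -- Uniqueness at `elem` makes `e` equal to `a`, so `a` has an anchor loop.
  hasRun : HasRun φ ψ
  hasRun
    with a , a∈ , ha ← count-witness (inter (role anchorRole) (concept anchor)) elem (ars elem) (sees-anchor elem)
    with ga , a-anchor ← ∧⁻ (rol anchorRole elem a) ha
    with e , e∈ , he ← count-witness (inter (role anchorRole) (concept anchor)) a (ars a) (sees-anchor a)
    with ae , e-anchor ← ∧⁻ (rol anchorRole a e) he
    with ge ← anchor-transitive elem a e ga ae
    with refl ← count-unique (inter (role anchorRole) (concept anchor)) elem (sees-anchor elem) a∈ (ars-complete _ elem e ge)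
                  ha (∧⁺ ge e-anchor)
    with a∈E , h ← ∧⁻ (conc 0 a) (anchor-axiom a a-anchor)
    with hlink , hφ ← ∧⁻ (⟦ link anchorRole 0 false ⟧c a) h
    = run-from (state false a a∈E (link-loop anchorRole 0 false a hlink a∈E ae)) hφ

consistent⇒run : ∀ φ ψ → Consistent (encode φ ψ) → HasRun φ ψ
consistent⇒run φ ψ (I , model) = Chain.hasRun I φ ψ model

-- From a run to a model

<ᵇ⁻ : ∀ {m n} → (m <ᵇ n) ≡ true → m < n
<ᵇ⁻ {m} {n} = <ᵇ⇒< m n ∘ Equivalence.from T-≡

<ᵇ⁺ : ∀ {m n} → m < n → (m <ᵇ n) ≡ true
<ᵇ⁺ = Equivalence.to T-≡ ∘ <⇒<ᵇ

-- (b , k , 0) is the k-th chain element labelled b, and (b , k , suc j) the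
-- j-th counter of the k-th cluster of roleOf b.
Element : Set
Element = Bool × ℕ × ℕ

_≟ᴱ_ : DecidableEquality Element
_≟ᴱ_ = ≡-dec _≟ᵇ_ (≡-dec _≟_ _≟_)

-- The cluster of roleOf r that contains the chain element (b , k , 0).
cluster : Bool → Bool → ℕ → ℕ
cluster false true k = suc k
cluster _     _    k = k

cluster-same : ∀ b k → cluster b b k ≡ k
cluster-same false k = refl
cluster-same true  k = refl

cluster-injective : ∀ r b {k k′} → cluster r b k ≡ cluster r b k′ → k ≡ k′
cluster-injective false false h = h
cluster-injective false true  h = suc-injective h
cluster-injective true  false h = h
cluster-injective true  true  h = h

-- This is the position of `(b , k , 0)` in the chain, and also the time whose register values the
-- `k`-th cluster of `roleOf b` stores.
time : Bool → ℕ → ℕ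
time false k = even k
time true  k = odd k

time-next : ∀ b k → time (not b) (cluster (not b) b k) ≡ suc (time b k)
time-next false k = refl
time-next true  k = refl

-- Serves as a common upper bound for the values below `n`.
sumBelow : ℕ → (ℕ → ℕ) → ℕ
sumBelow zero    f = 0
sumBelow (suc n) f = f n + sumBelow n f

≤-sumBelow : ∀ n f {c} → c < n → f c ≤ sumBelow n f
≤-sumBelow (suc n) f c<1+n with m≤n⇒m<n∨m≡n (s≤s⁻¹ c<1+n)
... | inj₁ c<n  = ≤-trans (≤-sumBelow n f c<n) (m≤n+m _ (f n))
... | inj₂ refl = m≤m+n _ _

module Model (φ ψ : Formula) (w : ℕ → ℕ → ℕ) (run : IsRun φ ψ w) where

  B : ℕ
  B = bound φ ⊔ bound ψ

  -- Registers are overlapping initial segments of one supply of counters, so the supply has to be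
  -- as large as each single value.
  capacity : Bool → ℕ → ℕ
  capacity r m = sumBelow B (w (time r m))

  inCluster : Bool → ℕ → Element → Bool
  inCluster r m (b , k , zero)  = m ≡ᵇ cluster r b k
  inCluster false m (false , k , suc j) = (m ≡ᵇ k) ∧ (j <ᵇ capacity false k)
  inCluster true  m (true  , k , suc j) = (m ≡ᵇ k) ∧ (j <ᵇ capacity true k)
  inCluster _     m (_ , k , suc j) = false

  isAnchor : Element → Bool
  isAnchor (false , zero , zero) = true
  isAnchor _                     = false

  clusterRole : Bool → Element → Element → Bool
  clusterRole r (b , k , zero)  e = inCluster r (cluster r b k) e
  clusterRole r (b , k , suc _) e = false

  -- The anchor is seen from everywhere, counters included, because the anchor axiom concerns all
  -- elements.
  roles : ℕ → Element → Element → Bool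
  roles 0 d e = clusterRole false d e
  roles 1 d e = clusterRole true d e
  roles 2 d e = isAnchor e
  roles 3 d e = clusterRole false d e
  roles 4 d e = clusterRole true d e
  roles 5 d e = isAnchor e
  roles _ d e = false

  concepts : ℕ → Element → Bool
  concepts 0 (false , _ , zero) = true
  concepts 1 (true  , _ , zero) = true
  concepts 2 e                  = isAnchor e
  concepts (suc (suc (suc c))) (b , k , suc j) = j <ᵇ w (time b k) c
  concepts _ _ = false

  counters : Bool → ℕ → ℕ → List Element
  counters b k n = map (λ j → b , k , suc j) (upTo n)

  -- Overapproximates the m-th cluster of roleOf r.
  candidates : Bool → ℕ → List Element
  candidates r m =
    (false , m , 0) ∷ (true , m , 0) ∷ (true , pred m , 0) ∷ counters r m (capacity r m)

  inCluster⇒candidate : ∀ r m e → inCluster r m e ≡ true → e ∈ candidates r m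
  inCluster⇒candidate false m (false , k , zero) h with refl ← ≡ᵇ⁻ {m} h = here refl
  inCluster⇒candidate true  m (false , k , zero) h with refl ← ≡ᵇ⁻ {m} h = here refl
  inCluster⇒candidate false m (true , k , zero) h with refl ← ≡ᵇ⁻ {m} h = there (there (here refl))
  inCluster⇒candidate true  m (true , k , zero) h with refl ← ≡ᵇ⁻ {m} h = there (here refl)
  inCluster⇒candidate false m (false , k , suc j) h
    with h₁ , h₂ ← ∧⁻ (m ≡ᵇ k) h with refl ← ≡ᵇ⁻ {m} h₁ =
    there (there (there (∈-map⁺ _ (∈-upTo⁺ (<ᵇ⁻ h₂)))))
  inCluster⇒candidate true m (true , k , suc j) h
    with h₁ , h₂ ← ∧⁻ (m ≡ᵇ k) h with refl ← ≡ᵇ⁻ {m} h₁ =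
    there (there (there (∈-map⁺ _ (∈-upTo⁺ (<ᵇ⁻ h₂)))))

  related : Element → Element → Bool
  related d e = clusterRole false d e ∨ clusterRole true d e ∨ isAnchor e

  possible : Element → List Element
  possible (b , k , _) = (false , 0 , 0) ∷
    candidates false (cluster false b k) ++ candidates true (cluster true b k)

  clusterRole⇒possible : ∀ r d e → clusterRole r d e ≡ true → e ∈ possible d
  clusterRole⇒possible false (b , k , zero) e h = there (∈-++⁺ˡ (inCluster⇒candidate false _ e h))
  clusterRole⇒possible true  (b , k , zero) e h =
    there (∈-++⁺ʳ (candidates false (cluster false b k)) (inCluster⇒candidate true _ e h))

  isAnchor⁻ : ∀ e → isAnchor e ≡ true → e ≡ (false , 0 , 0)
  isAnchor⁻ (false , zero , zero) h = refl

  roles⇒related : ∀ r d e → roles r d e ≡ true → related d e ≡ true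
  roles⇒related 0 d e h = ∨⁺ˡ h
  roles⇒related 1 d e h = ∨⁺ʳ {clusterRole false d e} (∨⁺ˡ h)
  roles⇒related 2 d e h = ∨⁺ʳ {clusterRole false d e} (∨⁺ʳ {clusterRole true d e} h)
  roles⇒related 3 d e h = ∨⁺ˡ h
  roles⇒related 4 d e h = ∨⁺ʳ {clusterRole false d e} (∨⁺ˡ h)
  roles⇒related 5 d e h = ∨⁺ʳ {clusterRole false d e} (∨⁺ʳ {clusterRole true d e} h)

  related⇒roles : ∀ d e → related d e ≡ true → ∃ λ r → roles r d e ≡ true
  related⇒roles d e h with ∨⁻ (clusterRole false d e) h
  ... | inj₁ h′ = 0 , h′
  ... | inj₂ h′ with ∨⁻ (clusterRole true d e) h′
  ...   | inj₁ h″ = 1 , h″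
  ...   | inj₂ h″ = 2 , h″

  related⇒possible : ∀ d e → related d e ≡ true → e ∈ possible d
  related⇒possible d e h with ∨⁻ (clusterRole false d e) h
  ... | inj₁ h′ = clusterRole⇒possible false d e h′
  ... | inj₂ h′ with ∨⁻ (clusterRole true d e) h′
  ...   | inj₁ h″ = clusterRole⇒possible true d e h″
  ...   | inj₂ h″ with refl ← isAnchor⁻ e h″ = here refl

  interp : Interp
  interp = record
    { Δ            = Element
    ; elem         = false , 0 , 0
    ; conc         = concepts
    ; rol          = roles
    -- Filtering removes the candidates that are not successors, such as `(true , pred m , 0)` for
    -- `m` equal to 0 in a cluster of `roleOf false`.
    ; ars          = λ d → filter (T? ∘ related d) (deduplicate _≟ᴱ_ (possible d))
    ; ars-unique   = λ d → Unique.filter⁺ (T? ∘ related d) (DecUnique.deduplicate-! _≟ᴱ_ (possible d))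
    ; ars-complete = λ r d e h →
        let rel = roles⇒related r d e h in
        ∈-filter⁺ (T? ∘ related d) (∈-deduplicate⁺ _≟ᴱ_ (related⇒possible d e rel)) (Equivalence.from T-≡ rel)
    ; ars-sound    = λ d e e∈ →
        related⇒roles d e (Equivalence.to T-≡ (proj₂ (∈-filter⁻ (T? ∘ related d) {xs = deduplicate _≟ᴱ_ (possible d)} e∈)))
    }

  open Interp interp using (ars; ars-complete)
  open Sem interp
  open Counting interp
  open Formulas interp

  roleOf-role : ∀ r d e → roles (roleOf r) d e ≡ clusterRole r d e
  roleOf-role false d e = refl
  roleOf-role true  d e = refl

  roleOf-seen : ∀ r d e → roles (roleOf r) d e ≡ true → e ∈ ars d
  roleOf-seen r = ars-complete (roleOf r)

  label⁻ : ∀ b e → concepts (roleOf b) e ≡ true → ∃ λ k → e ≡ (b , k , 0)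
  label⁻ false (false , k , zero) h = k , refl
  label⁻ true  (true  , k , zero) h = k , refl

  label⁺ : ∀ b k → concepts (roleOf b) (b , k , 0) ≡ true
  label⁺ false k = refl
  label⁺ true  k = refl

  inCluster-chain⁺ : ∀ r m b k → m ≡ cluster r b k → inCluster r m (b , k , 0) ≡ true
  inCluster-chain⁺ false m b k = ≡ᵇ⁺
  inCluster-chain⁺ true  m b k = ≡ᵇ⁺

  inCluster-chain⁻ : ∀ r m b k → inCluster r m (b , k , 0) ≡ true → m ≡ cluster r b k
  inCluster-chain⁻ false m b k = ≡ᵇ⁻
  inCluster-chain⁻ true  m b k = ≡ᵇ⁻

  role-chain⁺ : ∀ r b k b′ k′ → cluster r b k ≡ cluster r b′ k′ →
                roles (roleOf r) (b , k , 0) (b′ , k′ , 0) ≡ true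
  role-chain⁺ r b k b′ k′ h =
    ≡-trans (roleOf-role r _ _) (inCluster-chain⁺ r (cluster r b k) b′ k′ h)

  role-chain⁻ : ∀ r b k b′ k′ → roles (roleOf r) (b , k , 0) (b′ , k′ , 0) ≡ true →
                cluster r b k ≡ cluster r b′ k′
  role-chain⁻ r b k b′ k′ h =
    inCluster-chain⁻ r (cluster r b k) b′ k′ (≡-trans (sym (roleOf-role r (b , k , 0) (b′ , k′ , 0))) h)

  inCluster-counter⁻ : ∀ r m b k j → inCluster r m (b , k , suc j) ≡ true → b ≡ r × k ≡ m
  inCluster-counter⁻ false m false k j h = refl , sym (≡ᵇ⁻ (proj₁ (∧⁻ (m ≡ᵇ k) h)))
  inCluster-counter⁻ true  m true  k j h = refl , sym (≡ᵇ⁻ (proj₁ (∧⁻ (m ≡ᵇ k) h)))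

  inCluster-counter⁺ : ∀ r m j → j < capacity r m → inCluster r m (r , m , suc j) ≡ true
  inCluster-counter⁺ false m j h = ∧⁺ (≡ᵇ⁺ {m} refl) (<ᵇ⁺ h)
  inCluster-counter⁺ true  m j h = ∧⁺ (≡ᵇ⁺ {m} refl) (<ᵇ⁺ h)

  exactlyOne-holds : ∀ s d e → e ∈ ars d → ⟦ s ⟧s d e ≡ true →
                     (∀ e′ → ⟦ s ⟧s d e′ ≡ true → e′ ≡ e) → ⟦ exactlyOne s ⟧c d ≡ true
  exactlyOne-holds s d e e∈ e∈s unique = exactlyOne⁺ s d
    (count-list s d (e ∷ []) ([] ∷ []) (λ e′ _ h → here (unique e′ h)) λ { _ (here refl) → e∈ , e∈s })

  -- The set consists of the first `n` counters of the cluster; `≤-sumBelow` guarantees that the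
  -- cluster has that many.
  ∣register∣≡ : ∀ r b k c → c < B →
    ∣ inter (role (roleOf r)) (register c) ∣at (b , k , 0) ≡ w (time r (cluster r b k)) c
  ∣register∣≡ r b k c c<B = ≡-trans
    (count-list (inter (role (roleOf r)) (register c)) d (counters r m n)
      (Unique.map⁺ (suc-injective ∘ ,-injectiveʳ ∘ ,-injectiveʳ) (Unique.upTo⁺ n)) only all)
    (≡-trans (length-map _ (upTo n)) (length-upTo n))
    where
    d = b , k , 0
    m = cluster r b k
    n = w (time r m) c
    only : ∀ e → e ∈ ars d → roles (roleOf r) d e ∧ concepts (3 + c) e ≡ true → e ∈ counters r m n
    only e@(b′ , k′ , suc j) _ h
      with h₁ , h₂ ← ∧⁻ (roles (roleOf r) d e) h
      with refl , refl ← inCluster-counter⁻ r m b′ k′ j (≡-trans (sym (roleOf-role r d e)) h₁)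
      = ∈-map⁺ _ (∈-upTo⁺ (<ᵇ⁻ h₂))
    only e@(b′ , k′ , zero) _ h with () ← proj₂ (∧⁻ (roles (roleOf r) d e) h)
    all : ∀ e → e ∈ counters r m n → e ∈ ars d × roles (roleOf r) d e ∧ concepts (3 + c) e ≡ true
    all e e∈ with j , j∈ , refl ← ∈-map⁻ (λ j → r , m , suc j) e∈ =
      roleOf-seen r d e seen , ∧⁺ seen (<ᵇ⁺ (∈-upTo⁻ j∈))
      where
      seen : roles (roleOf r) d (r , m , suc j) ≡ true
      seen = ≡-trans (roleOf-role r d _)
        (inCluster-counter⁺ r m j (<-≤-trans (∈-upTo⁻ j∈) (≤-sumBelow B (w (time r m)) c<B)))

  -- Injectivity of `cluster r b` leaves room for one chain element per label in a cluster. This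
  -- yields the cardinalities in `link`, in `advance` and for `one`.
  cluster-label : ∀ r b b′ k k′ → cluster r b′ k′ ≡ cluster r b k →
                  ⟦ exactlyOne (inter (role (roleOf r)) (label b)) ⟧c (b′ , k′ , 0) ≡ true
  cluster-label r b b′ k k′ same = exactlyOne-holds (inter (role (roleOf r)) (label b)) d e
    (roleOf-seen r d e seen) (∧⁺ seen (label⁺ b k)) unique
    where
    d = b′ , k′ , 0
    e = b , k , 0
    seen : roles (roleOf r) d e ≡ true
    seen = role-chain⁺ r b′ k′ b k same
    unique : ∀ x → roles (roleOf r) d x ∧ concepts (roleOf b) x ≡ true → x ≡ e
    unique x h
      with h₁ , h₂ ← ∧⁻ (roles (roleOf r) d x) h
      with l , refl ← label⁻ b x h₂
      = cong (λ l → b , l , 0) (cluster-injective r b (≡-trans (sym (role-chain⁻ r b′ k′ b l h₁)) same))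

  role-own-label : ∀ r b k e → roles (roleOf r) (b , k , 0) e ≡ true → concepts (roleOf b) e ≡ true →
                   e ≡ (b , k , 0)
  role-own-label r b k e h e∈b with l , refl ← label⁻ b e e∈b =
    cong (λ l → b , l , 0) (sym (cluster-injective r b (role-chain⁻ r b k b l h)))

  -- The first role is arbitrary so that `anchorRole` and the cluster roles are covered together.
  link-holds : ∀ r r′ b k → roles r (b , k , 0) (b , k , 0) ≡ true →
               (∀ e → roles r (b , k , 0) e ≡ true → concepts (roleOf b) e ≡ true → e ≡ (b , k , 0)) →
               ⟦ link r (roleOf r′) b ⟧c (b , k , 0) ≡ true
  link-holds r r′ b k loop r-unique = ∧⁺
    (exactlyOne-holds (inter (union (role r) (role (roleOf r′))) (label b)) d d
      (ars-complete r d d loop) (∧⁺ (∨⁺ˡ loop) (label⁺ b k)) unique)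
    (cluster-label r′ b b k k refl)
    where
    d = b , k , 0
    unique : ∀ e → (roles r d e ∨ roles (roleOf r′) d e) ∧ concepts (roleOf b) e ≡ true → e ≡ d
    unique e h with h₁ , e∈b ← ∧⁻ (roles r d e ∨ roles (roleOf r′) d e) h with ∨⁻ (roles r d e) h₁
    ... | inj₁ h₂ = r-unique e h₂ e∈b
    ... | inj₂ h₂ = role-own-label r′ b k e h₂ e∈b

  advance-holds : ∀ b k → ⟦ advance b ⟧c (b , k , 0) ≡ true
  advance-holds b k = exactlyOne-holds
    (inter (inter (role (roleOf out)) (label out)) (concept (exactlyOne (inter (role (roleOf out)) (label b)))))
    d e (roleOf-seen out d e seen)
    (∧⁺ (∧⁺ seen (label⁺ out m)) (cluster-label out b out k m (cluster-same out m))) unique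
    where
    out = not b
    -- By `cluster-same`, the element labelled `out` in cluster `m` of `out` has number `m` itself.
    m = cluster out b k
    d = b , k , 0
    e = out , m , 0
    seen : roles (roleOf out) d e ≡ true
    seen = role-chain⁺ out b k out m (sym (cluster-same out m))
    unique : ∀ x → (roles (roleOf out) d x ∧ concepts (roleOf out) x)
               ∧ ⟦ exactlyOne (inter (role (roleOf out)) (label b)) ⟧c x ≡ true → x ≡ e
    unique x h
      with h₁ , _ ← ∧⁻ (roles (roleOf out) d x ∧ concepts (roleOf out) x) h
      with h₂ , x∈out ← ∧⁻ (roles (roleOf out) d x) h₁
      with l , refl ← label⁻ out x x∈out
      = cong (λ l → out , l , 0) (≡-trans (sym (cluster-same out l)) (sym (role-chain⁻ out b k out l h₂)))

  formula-holds : ∀ χ b k → bound χ ≤ B → w (time b k) , w (suc (time b k)) ⊨ χ →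
                  ⟦ formulaConcept b χ ⟧c (b , k , 0) ≡ true
  formula-holds χ b k χ≤B h = formulaConcept⁺ b (b , k , 0) _ _ B
    (exactlyOne⁻ (termSet b one) (b , k , 0) (cluster-label (not b) b b k k refl))
    (λ c c<B → ≡-trans (∣register∣≡ b b k c c<B) (cong (λ m → w (time b m) c) (cluster-same b k)))
    (λ c c<B → ≡-trans (∣register∣≡ (not b) b k c c<B) (cong (λ t → w t c) (time-next b k)))
    χ χ≤B h

  -- A midpoint has a successor, so it is a chain element; lying in the cluster of `d`, it sees
  -- exactly that cluster.
  clusterRole-transitive : ∀ r d e f → clusterRole r d e ≡ true → clusterRole r e f ≡ true → clusterRole r d f ≡ true
  clusterRole-transitive r (b , k , zero) (b′ , k′ , zero) f h h′ =
    subst (λ m → inCluster r m f ≡ true) (sym (inCluster-chain⁻ r (cluster r b k) b′ k′ h)) h′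

  incl-equal : ∀ s t d xs → (∀ e → ⟦ s ⟧s d e ≡ ⟦ t ⟧s d e) → incl s t d xs ≡ true
  incl-equal s t d []       s≡t = refl
  incl-equal s t d (x ∷ xs) s≡t rewrite s≡t x with ⟦ t ⟧s d x
  ... | true  = incl-equal s t d xs s≡t
  ... | false = incl-equal s t d xs s≡t

  alias-holds : ∀ r → (∀ d e → roles r d e ≡ roles (3 + r) d e) → Satisfies (alias r)
  alias-holds r same d _ = ∧⁺ (incl-equal (role r) (role (3 + r)) d (ars d) (same d))
                              (incl-equal (role (3 + r)) (role r) d (ars d) (sym ∘ same d))

  stepAxiom-holds : ∀ b → Satisfies (stepAxiom ψ b)
  stepAxiom-holds b d h with k , refl ← label⁻ b d h = ∧⁺
    (link-holds (roleOf b) (not b) b k (role-chain⁺ b b k b k refl) (role-own-label b b k))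
    (∧⁺ (advance-holds b k) (formula-holds ψ b k (m≤n⊔m (bound φ) _) (IsRun.steps run (time b k))))

  isModel : IsModel (encode φ ψ)
  isModel _ (here refl) = clusterRole-transitive false
  isModel _ (there (here refl)) = clusterRole-transitive true
  isModel _ (there (there (here refl))) = λ d e f _ h → h
  isModel _ (there (there (there (here refl)))) = alias-holds 0 (λ _ _ → refl)
  isModel _ (there (there (there (there (here refl))))) = alias-holds 1 (λ _ _ → refl)
  isModel _ (there (there (there (there (there (here refl)))))) = alias-holds 2 (λ _ _ → refl)
  isModel _ (there (there (there (there (there (there (here refl))))))) = λ d _ →
    exactlyOne-holds (inter (role anchorRole) (concept anchor)) d (false , 0 , 0)
      (ars-complete 2 d (false , 0 , 0) refl) refl
      (λ e h → isAnchor⁻ e (proj₁ (∧⁻ (isAnchor e) h)))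
  isModel _ (there (there (there (there (there (there (there (here refl)))))))) = λ d h → anchor-holds d (isAnchor⁻ d h)
    where
    anchor-holds : ∀ d → d ≡ (false , 0 , 0) → ⟦ and (atom 0) (and (link anchorRole 0 false) (formulaConcept false φ)) ⟧c d ≡ true
    anchor-holds d refl = ∧⁺ (link-holds 2 false false 0 refl (λ e h _ → isAnchor⁻ e h))
      (formula-holds φ false 0 (m≤m⊔n (bound φ) _) (IsRun.initial run))
  isModel _ (there (there (there (there (there (there (there (there (here refl))))))))) = stepAxiom-holds false
  isModel _ (there (there (there (there (there (there (there (there (there (here refl)))))))))) = stepAxiom-holds true

run⇒consistent : ∀ φ ψ → HasRun φ ψ → Consistent (encode φ ψ)
run⇒consistent φ ψ (w , run) = Model.interp φ ψ w run , Model.isModel φ ψ w run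

-- Reduction of Diophantine solvability to consistency

theorem6 : Σ (Diophantine → TBox) (λ f → ((e : Diophantine) → Restricted (f e) ≡ true) × (((e : Diophantine) → Solvable e ⇔ Consistent (f e)) ⊎ ((e : Diophantine) → Solvable e ⇔ (¬ Consistent (f e)))))
theorem6 =
    (λ e → encode (initialFormula e) (stepFormula e))
  , (λ e → encode-restricted (initialFormula e) (stepFormula e))
  , inj₁ (λ e → mk⇔
      (run⇒consistent (initialFormula e) (stepFormula e) ∘ solvable⇒run e)
      (run⇒solvable e ∘ consistent⇒run (initialFormula e) (stepFormula e)))
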